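{- For every $n\ge1$, the polynomial $$\mathcal{A}_n(q,t):=\sum_{\sigma\in\mathcal{S}_n(231)}q^{\operatorname{maj}(\sigma)}\,t^{\binom{n}{2}-\operatorname{imaj}(\sigma)}$$ is symmetric in $q$ and $t$, i.e. $\mathcal{A}_n(q,t)=\mathcal{A}_n(t,q)$.
   Context: $\mathcal{S}_n$ is the symmetric group on $\{1,\dots,n\}$; $\mathcal{S}_n(231)$ is the set of $\sigma\in\mathcal{S}_n$ with no $i<j<k$ satisfying $\sigma_k<\sigma_i<\sigma_j$. The descent set is $\operatorname{Des}(\sigma)=\{i : 1\le i<n,\ \sigma_i>\sigma_{i+1}\}$, $\operatorname{maj}(\sigma)=\sum_{i\in\operatorname{Des}(\sigma)}i$, and $\operatorname{imaj}(\sigma)=\operatorname{maj}(\sigma^{ -1})$. -}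

module Defs where

open import Algebra.Bundles using (RawSemiring)
import Algebra.Definitions.RawSemiring as RawSemiringDefinitions
open import Data.Fin.Base using (Fin; zero; suc; toℕ; punchIn; _<_)
open import Data.Fin.Properties using (_<?_; any?; punchIn-injective)
open import Data.Fin.Permutation
  using (Permutation′; _⟨$⟩ʳ_; _≈_; id; flip; insert; remove; insert-remove; insert-punchIn)
open import Data.Integer.Base as ℤ using (ℤ; 0ℤ; 1ℤ)
open import Data.List.Base
  using (List; []; _∷_; [_]; _++_; map; foldr; filter; allFin; cartesianProductWith)
import Data.List.Membership.Setoid as Membership
import Data.List.Membership.Setoid.Properties as Membershipₚ
open import Data.List.Membership.Propositional.Properties using (∈-allFin)
open import Data.List.Relation.Unary.All using ([])
open import Data.List.Relation.Unary.AllPairs using ([]; _∷_)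
open import Data.List.Relation.Unary.Any using (here)
open import Data.List.Relation.Unary.Unique.Propositional.Properties using (allFin⁺)
open import Data.List.Relation.Unary.Unique.Setoid using (Unique)
import Data.List.Relation.Unary.Unique.Setoid.Properties as Unique
open import Data.Nat.Base as ℕ using (ℕ; zero; suc; _∸_)
open import Data.Nat.Combinatorics using (_C_)
open import Data.Nat.ListAction using (sum)
import Data.Nat.Properties as ℕ
open import Data.Product.Base using (_×_; _,_; ∃-syntax)
open import Level using (0ℓ)
open import Relation.Binary.Bundles using (Setoid)
open import Relation.Binary.PropositionalEquality using (_≡_; refl; sym; trans; cong; setoid)
open import Relation.Nullary.Decidable using (Dec; yes; no; _×-dec_; ¬?)
open import Relation.Nullary.Negation using (¬_)

private
  variable
    n : ℕ

------------------------------------------------------------------------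
-- Permutations
--
-- The symmetric group is Permutation′ n, acting on Fin n = {0,…,n-1}
-- instead of {1,…,n}; σᵢ is σ ⟨$⟩ʳ i and σ⁻¹ is flip σ.

-- A permutation of Fin (suc n) amounts to the image of zero together
-- with the permutation of Fin n left after deleting zero and its image.
𝒮 : ∀ n → List (Permutation′ n)
𝒮 zero    = [ id ]
𝒮 (suc n) = cartesianProductWith (insert zero) (allFin (suc n)) (𝒮 n)

-- 𝒮-complete and 𝒮-unique: up to pointwise equality, every permutation
-- occurs in 𝒮 n exactly once.

≈-setoid : ℕ → Setoid 0ℓ 0ℓ
≈-setoid n = record
  { Carrier       = Permutation′ n
  ; _≈_           = _≈_
  ; isEquivalence = record
    { refl  = λ _ → refl
    ; sym   = λ p i → sym (p i)
    ; trans = λ p q i → trans (p i) (q i)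
    }
  }

insert-cong : ∀ {j k} {π ρ : Permutation′ n} →
              j ≡ k → π ≈ ρ → insert zero j π ≈ insert zero k ρ
insert-cong         refl π≈ρ zero    = refl
insert-cong {j = j} refl π≈ρ (suc i) = cong (punchIn j) (π≈ρ i)

insert-injective : ∀ {j k} {π ρ : Permutation′ n} →
                   insert zero j π ≈ insert zero k ρ → j ≡ k × π ≈ ρ
insert-injective {j = j} {π = π} {ρ} eq with refl ← eq zero =
  refl , λ i → punchIn-injective j _ _
    (trans (sym (insert-punchIn zero j π i))
    (trans (eq (suc i)) (insert-punchIn zero j ρ i)))

𝒮-complete : ∀ n (π : Permutation′ n) → let open Membership (≈-setoid n) in π ∈ 𝒮 n
𝒮-complete zero    π = here λ ()
𝒮-complete (suc n) π =
  Membershipₚ.∈-resp-≈ (≈-setoid (suc n))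
    {x = insert zero (π ⟨$⟩ʳ zero) (remove zero π)} {y = π} (insert-remove zero π)
    (Membershipₚ.∈-cartesianProductWith⁺
      (setoid (Fin (suc n))) (≈-setoid n) (≈-setoid (suc n))
      (λ {_} {_} {π} {ρ} → insert-cong {π = π} {ρ})
      (∈-allFin (π ⟨$⟩ʳ zero)) (𝒮-complete n (remove zero π)))

𝒮-unique : ∀ n → Unique (≈-setoid n) (𝒮 n)
𝒮-unique zero    = [] ∷ []
𝒮-unique (suc n) =
  Unique.cartesianProductWith⁺
    (setoid (Fin (suc n))) (≈-setoid n) (≈-setoid (suc n)) (insert zero)
    (λ {_} {_} {π} {ρ} → insert-injective {π = π} {ρ})
    (allFin⁺ (suc n)) (𝒮-unique n)

------------------------------------------------------------------------
-- Pattern avoidance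

Contains231 : Permutation′ n → Set
Contains231 σ = ∃[ i ] ∃[ j ] ∃[ k ]
  (i < j × j < k × (σ ⟨$⟩ʳ k) < (σ ⟨$⟩ʳ i) × (σ ⟨$⟩ʳ i) < (σ ⟨$⟩ʳ j))

Avoids231 : Permutation′ n → Set
Avoids231 σ = ¬ Contains231 σ

avoids231? : (σ : Permutation′ n) → Dec (Avoids231 σ)
avoids231? σ = ¬? (any? λ i → any? λ j → any? λ k →
  (i <? j) ×-dec (j <? k) ×-dec
  ((σ ⟨$⟩ʳ k) <? (σ ⟨$⟩ʳ i)) ×-dec ((σ ⟨$⟩ʳ i) <? (σ ⟨$⟩ʳ j)))

𝒮⟨231⟩ : ∀ n → List (Permutation′ n)
𝒮⟨231⟩ n = filter avoids231? (𝒮 n)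

------------------------------------------------------------------------
-- Descents and major indices

-- The index j is the successor position i + 1; its existence excludes
-- the last position.
IsDescent : Permutation′ n → Fin n → Set
IsDescent σ i = ∃[ j ] (toℕ j ≡ suc (toℕ i) × (σ ⟨$⟩ʳ j) < (σ ⟨$⟩ʳ i))

isDescent? : (σ : Permutation′ n) (i : Fin n) → Dec (IsDescent σ i)
isDescent? σ i = any? λ j →
  (toℕ j ℕ.≟ suc (toℕ i)) ×-dec ((σ ⟨$⟩ʳ j) <? (σ ⟨$⟩ʳ i))

Des : Permutation′ n → List (Fin n)
Des {n} σ = filter (isDescent? σ) (allFin n)

-- Positions are counted from 1 in the major index.
maj : Permutation′ n → ℕ
maj σ = sum (map (λ i → suc (toℕ i)) (Des σ))

imaj : Permutation′ n → ℕ
imaj σ = maj (flip σ)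

------------------------------------------------------------------------
-- Polynomials in two variables over ℤ

-- (c , a , b) stands for the term c qᵃ tᵇ, and a list for the sum of its
-- terms.  Lists may repeat or cancel exponents, so polynomials are
-- compared by _≈ₚ_, equality of all coefficients.
Polynomial : Set
Polynomial = List (ℤ × ℕ × ℕ)

coefficient : Polynomial → ℕ → ℕ → ℤ
coefficient []                a b = 0ℤ
coefficient ((c , a′ , b′) ∷ p) a b with (a′ ℕ.≟ a) ×-dec (b′ ℕ.≟ b)
... | yes _ = c ℤ.+ coefficient p a b
... | no  _ = coefficient p a b

infix 4 _≈ₚ_
_≈ₚ_ : Polynomial → Polynomial → Set
p ≈ₚ r = ∀ a b → coefficient p a b ≡ coefficient r a b

_*ₜ_ : ℤ × ℕ × ℕ → ℤ × ℕ × ℕ → ℤ × ℕ × ℕ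
(c , a , b) *ₜ (c′ , a′ , b′) = c ℤ.* c′ , a ℕ.+ a′ , b ℕ.+ b′

polynomialRawSemiring : RawSemiring 0ℓ 0ℓ
polynomialRawSemiring = record
  { Carrier = Polynomial
  ; _≈_     = _≈ₚ_
  ; _+_     = _++_
  ; _*_     = cartesianProductWith _*ₜ_
  ; 0#      = []
  ; 1#      = [ (1ℤ , 0 , 0) ]
  }

open RawSemiring polynomialRawSemiring using (_+_; _*_; 0#)
open RawSemiringDefinitions polynomialRawSemiring using (_^_)

q t : Polynomial
q = [ (1ℤ , 1 , 0) ]
t = [ (1ℤ , 0 , 1) ]

-- Every descent set is contained in {1,…,n-1}, so imaj σ ≤ n C 2 and the
-- subtraction is not truncated.
𝒜 : ℕ → Polynomial → Polynomial → Polynomial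
𝒜 n x y = foldr _+_ 0# (map (λ σ → x ^ maj σ * y ^ (n C 2 ∸ imaj σ)) (𝒮⟨231⟩ n))

module Submission where

-- A permutation avoiding 231 is determined by its descent set D and the
-- descent set E of its inverse, and the pairs (D , E) that occur are those
-- with |D| = |E| in which every set {1,…,p} contains at least as many
-- elements of D as of E.  Equivalently, reading the membership of
-- 1,…,n-1 in D and in E letter by letter gives a two-coloured Motzkin
-- path: an element of D alone is an up step, of E alone a down step, and
-- the elements of neither and of both are the two colours of level steps.
-- Exchanging the colours replaces (D , E) by the pair of complements
-- (Eᶜ , Dᶜ).  Since the elements of {1,…,n-1} add up to n C 2, this
-- involution exchanges maj with n C 2 ∸ imaj, and the polynomial is
-- symmetric.
--
-- The correspondence is built by inserting the first value J of σ into
-- the permutation π left after deleting it.  The result avoids 231 if and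
-- only if π does and J splits π, meaning that the values below J stand to
-- the left of the others (avoids-insert⁺, avoids-insert⁻,
-- avoids-insert⇒splits).  For J = 0 the path of σ is that of π with a low
-- step in front.  For J = k + 1 the descent word of σ is that of π with
-- true in front, and the descent word of σ⁻¹ is that of π⁻¹ with true
-- inserted at k; on paths this is the operation glue.  The values that
-- split π are found on its path: k + 1 splits π exactly when the path has
-- a cut at k, that is, stands at height 0 and ends or makes a low step
-- (cut⇒splits, splits⇒cut).  Every nonempty path from height 0 arises
-- from exactly one of the two operations (view, view-glue), so paths
-- decode to permutations (codes-decode), every 231-avoiding permutation
-- has a code (encode), and the words of the code mark the descents
-- (codes⇒marks-des, codes⇒marks-ides).
--
-- For the coefficients, transporting the exchange of colours along the
-- coding gives an injection of the permutations with maj = a and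
-- n C 2 ∸ imaj = b into those with the two values exchanged
-- (count-swap-≤); by antisymmetry the two numbers are equal.

open import Defs
open import Data.Nat.Base using (ℕ; _≥_)

open import Algebra.Bundles using (RawSemiring)
import Algebra.Definitions.RawSemiring as RawSemiringDefinitions
open import Data.Bool.Base using (Bool; true; false; if_then_else_)
open import Data.Fin.Base using (Fin; zero; suc; toℕ; punchIn; punchOut; _<_; _≤_)
open import Data.Fin.Permutation
  using (Permutation′; _⟨$⟩ʳ_; _⟨$⟩ˡ_; _≈_; id; flip; insert; remove; insert-remove;
         inverseˡ; inverseʳ)
open import Data.Fin.Properties
  using (_≟_; injective⇒≤; toℕ-injective; punchIn-punchOut; punchIn-mono-≤; punchIn-cancel-≤)
open import Data.Integer.Base as ℤ using (1ℤ)
open import Data.List.Base using ([]; _∷_; foldr; map; filter; tabulate; lookup; length)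
import Data.List.Membership.Setoid as Membership
import Data.List.Membership.Setoid.Properties as Membershipₚ
open import Data.List.Membership.Propositional.Properties using (∈-lookup)
open import Data.List.Properties using (filter-accept; filter-reject)
import Data.List.Relation.Unary.All as All
open import Data.List.Relation.Unary.AllPairs using (_∷_)
open import Data.List.Relation.Unary.Any using (index)
open import Data.List.Relation.Unary.Unique.Setoid using (Unique)
import Data.List.Relation.Unary.Unique.Setoid.Properties as Unique
open import Data.Nat.Base as ℕ using (zero; suc; _∸_; z≤n; s≤s; s≤s⁻¹; s<s⁻¹)
open import Data.Nat.Combinatorics using (_C_; nC1≡n; nCk+nC[k+1]≡[n+1]C[k+1])
open import Data.Nat.ListAction using (sum)
import Data.Nat.Properties as ℕ
open import Data.Nat.Solver using (module +-*-Solver)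
open import Data.Product.Base using (_×_; _,_; ∃-syntax; proj₁; proj₂)
open import Function.Base using (_∘_)
open import Relation.Binary.Bundles using (Setoid)
open import Relation.Binary.PropositionalEquality
  using (_≡_; _≢_; refl; sym; trans; cong; cong₂; subst; subst₂)
open import Relation.Nullary.Decidable
  using (Dec; yes; no; does; proof; _because_; map′; _×-dec_)
open import Relation.Nullary.Negation using (¬_; contradiction)
open import Relation.Nullary.Reflects using (Reflects; ofʸ; ofⁿ; det)

private
  variable
    h h′ m n : ℕ

-- Two-coloured Motzkin paths

-- A step from the first height to the second.  Step i of the path of σ
-- records whether i is a descent of σ (inDes) and whether it is a descent
-- of σ⁻¹ (inIDes); the height is the number of descents of σ so far minus
-- that of descents of σ⁻¹.
data Letter : ℕ → ℕ → Set where
  up   : Letter h (suc h)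
  down : Letter (suc h) h
  low  : Letter h h
  high : Letter h h

inDes : Letter h h′ → Bool
inDes up   = true
inDes down = false
inDes low  = false
inDes high = true

inIDes : Letter h h′ → Bool
inIDes up   = false
inIDes down = true
inIDes low  = false
inIDes high = true

-- Paths of a given length from a given height down to height 0.
infixr 5 _∷_
data Motzkin : ℕ → ℕ → Set where
  []  : Motzkin 0 0
  _∷_ : Letter h h′ → Motzkin h′ m → Motzkin h (suc m)

-- The words of inDes and inIDes along a path.  A path of length m belongs
-- to a permutation of suc m points, whose last position is never a
-- descent; accordingly both words get a final letter false.
des : Motzkin h m → Fin (suc m) → Bool
des []      _       = false
des (l ∷ p) zero    = inDes l
des (l ∷ p) (suc i) = des p i

ides : Motzkin h m → Fin (suc m) → Bool
ides []      _       = false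
ides (l ∷ p) zero    = inIDes l
ides (l ∷ p) (suc i) = ides p i

des-ides-injective : (p p′ : Motzkin h m) → (∀ i → des p i ≡ des p′ i) →
                     (∀ i → ides p i ≡ ides p′ i) → p ≡ p′
des-ides-injective []      []        _ _ = refl
des-ides-injective (l ∷ p) (l′ ∷ p′) d e = go l l′ (d zero) (e zero) p p′ (d ∘ suc) (e ∘ suc)
  where
  go : ∀ {h h₁ h₂ m} (l : Letter h h₁) (l′ : Letter h h₂) →
       inDes l ≡ inDes l′ → inIDes l ≡ inIDes l′ →
       (p : Motzkin h₁ m) (p′ : Motzkin h₂ m) →
       (∀ i → des p i ≡ des p′ i) → (∀ i → ides p i ≡ ides p′ i) →
       _≡_ {A = Motzkin h (suc m)} (l ∷ p) (l′ ∷ p′)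
  go up   up   _ _ p p′ d e = cong (up ∷_) (des-ides-injective p p′ d e)
  go down down _ _ p p′ d e = cong (down ∷_) (des-ides-injective p p′ d e)
  go low  low  _ _ p p′ d e = cong (low ∷_) (des-ides-injective p p′ d e)
  go high high _ _ p p′ d e = cong (high ∷_) (des-ides-injective p p′ d e)

-- Exchange of the two colours of level steps.
swapLetter : Letter h h′ → Letter h h′
swapLetter up   = up
swapLetter down = down
swapLetter low  = high
swapLetter high = low

swap : Motzkin h m → Motzkin h m
swap []      = []
swap (l ∷ p) = swapLetter l ∷ swap p

swap-involutive : (p : Motzkin h m) → swap (swap p) ≡ p
swap-involutive []         = refl
swap-involutive (up ∷ p)   = cong (up ∷_) (swap-involutive p)
swap-involutive (down ∷ p) = cong (down ∷_) (swap-involutive p)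
swap-involutive (low ∷ p)  = cong (low ∷_) (swap-involutive p)
swap-involutive (high ∷ p) = cong (high ∷_) (swap-involutive p)

-- Cutting and gluing paths

-- Cut p k: the path can be cut before its step k, because it stands at
-- height 0 there and either ends or continues with a low step.
data Cut : Motzkin h m → Fin (suc m) → Set where
  final : Cut [] zero
  here  : {p : Motzkin 0 m} → Cut (low ∷ p) zero
  there : ∀ {k} {l : Letter h h′} {p : Motzkin h′ m} → Cut p k → Cut (l ∷ p) (suc k)

-- glue c cut puts the letter c in front of the word des and inserts the
-- letter true into the word ides at the cut.  Before the cut, each step
-- keeps its letter inIDes and receives the letter inDes of the step before
-- it, or c at the beginning; at the cut a step is added that releases the
-- letter still held.  Because the added letter of ides is true, the path
-- starts at the same height if c is true and one higher if c is false.
lift : Bool → ℕ → ℕ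
lift true  h = h
lift false h = suc h

-- The step l with its letter inDes replaced by c.
carry : (c : Bool) (l : Letter h h′) → Letter (lift c h) (lift (inDes l) h′)
carry true  up   = up
carry true  down = high
carry true  low  = up
carry true  high = high
carry false up   = low
carry false down = down
carry false low  = low
carry false high = down

inDes-carry : ∀ c (l : Letter h h′) → inDes (carry c l) ≡ c
inDes-carry true  up   = refl
inDes-carry true  down = refl
inDes-carry true  low  = refl
inDes-carry true  high = refl
inDes-carry false up   = refl
inDes-carry false down = refl
inDes-carry false low  = refl
inDes-carry false high = refl

inIDes-carry : ∀ c (l : Letter h h′) → inIDes (carry c l) ≡ inIDes l
inIDes-carry true  up   = refl
inIDes-carry true  down = refl
inIDes-carry true  low  = refl
inIDes-carry true  high = refl
inIDes-carry false up   = refl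
inIDes-carry false down = refl
inIDes-carry false low  = refl
inIDes-carry false high = refl

-- The added step is carry c high, because its letter inIDes is true.
glue : ∀ c {p : Motzkin h m} {k} → Cut p k → Motzkin (lift c h) (suc m)
glue c final               = carry c high ∷ []
glue c (here {p = p})      = carry c high ∷ low ∷ p
glue c (there {l = l} cut) = carry c l ∷ glue (inDes l) cut

des-glue-zero : ∀ c {p : Motzkin h m} {k} (cut : Cut p k) → des (glue c cut) zero ≡ c
des-glue-zero c final               = inDes-carry c high
des-glue-zero c here                = inDes-carry c high
des-glue-zero c (there {l = l} cut) = inDes-carry c l

des-glue-suc : ∀ c {p : Motzkin h m} {k} (cut : Cut p k) i →
               des (glue c cut) (suc i) ≡ des p i
des-glue-suc c final       zero    = refl
des-glue-suc c here        zero    = refl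
des-glue-suc c here        (suc i) = refl
des-glue-suc c (there {l = l} cut) zero    = des-glue-zero (inDes l) cut
des-glue-suc c (there {l = l} cut) (suc i) = des-glue-suc (inDes l) cut i

-- The word ides (glue c cut), indexed by suc k and by the positions
-- punchIn (suc k) w: the former is the value to be inserted into a
-- permutation, the latter are the values already there.
ides-glue-new : ∀ c {p : Motzkin h m} {k} (cut : Cut p k) → ides (glue c cut) (suc k) ≡ false
ides-glue-new c final               = refl
ides-glue-new c here                = refl
ides-glue-new c (there {l = l} cut) = ides-glue-new (inDes l) cut

ides-glue-cut : ∀ c {p : Motzkin h m} {k} (cut : Cut p k) →
                ides (glue c cut) (punchIn (suc k) k) ≡ true
ides-glue-cut c final               = inIDes-carry c high
ides-glue-cut c here                = inIDes-carry c high
ides-glue-cut c (there {l = l} cut) = ides-glue-cut (inDes l) cut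

ides-glue-old : ∀ c {p : Motzkin h m} {k} (cut : Cut p k) w → w ≢ k →
                ides (glue c cut) (punchIn (suc k) w) ≡ ides p w
ides-glue-old c final       zero    w≢k = contradiction refl w≢k
ides-glue-old c here        zero    w≢k = contradiction refl w≢k
ides-glue-old c here        (suc w) w≢k = refl
ides-glue-old c (there {l = l} cut) zero    w≢k = inIDes-carry c l
ides-glue-old c (there {l = l} cut) (suc w) w≢k = ides-glue-old (inDes l) cut w (w≢k ∘ cong suc)

¬cut-glue-zero : ∀ c {p : Motzkin h m} {k} (cut : Cut p k) → ¬ Cut (glue c cut) zero
¬cut-glue-zero true  final ()
¬cut-glue-zero false final ()
¬cut-glue-zero true  here ()
¬cut-glue-zero false here ()
¬cut-glue-zero true  (there {l = up}   cut) ()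
¬cut-glue-zero true  (there {l = down} cut) ()
¬cut-glue-zero true  (there {l = low}  cut) ()
¬cut-glue-zero true  (there {l = high} cut) ()
¬cut-glue-zero false (there {l = up}   cut) ()
¬cut-glue-zero false (there {l = down} cut) ()
¬cut-glue-zero false (there {l = low}  cut) ()
¬cut-glue-zero false (there {l = high} cut) ()

-- Gluing destroys the cuts before k and keeps the others.
cut-glue⁺ : ∀ c {p : Motzkin h m} {k k′} (cut : Cut p k) →
            k ≤ k′ → Cut p k′ → Cut (glue c cut) (suc k′)
cut-glue⁺ c final       _   final = there final
cut-glue⁺ c here        _   cut′  = there cut′
cut-glue⁺ c (there {l = l} cut) k≤k′ (there cut′) =
  there (cut-glue⁺ (inDes l) cut (s≤s⁻¹ k≤k′) cut′)

cut-glue⁻ : ∀ c {p : Motzkin h m} {k k′} (cut : Cut p k) →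
            Cut (glue c cut) (suc k′) → k ≤ k′ × Cut p k′
cut-glue⁻ c final (there final) = z≤n , final
cut-glue⁻ c here  (there cut′)  = z≤n , cut′
cut-glue⁻ c {k′ = zero}  (there {l = l} cut) (there cut′) =
  contradiction cut′ (¬cut-glue-zero (inDes l) cut)
cut-glue⁻ c {k′ = suc k′} (there {l = l} cut) (there cut′)
  with k≤k′ , cut″ ← cut-glue⁻ (inDes l) cut cut′ = s≤s k≤k′ , there cut″

-- The last step of the construction of a path.  Every path has exactly
-- one view: a path that starts with a low step at height 0 is not glued,
-- and in any other nonempty path the glued cut is found at the first low
-- step at height 0 or at the end.
data View : Motzkin h m → Set where
  flat  : View []
  lower : (p : Motzkin 0 m) → View (low ∷ p)
  glued : ∀ c {p : Motzkin h m} {k} (cut : Cut p k) → View (glue c cut)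

viewStep : {p : Motzkin h′ m} → View p → (l : Letter h h′) → View (l ∷ p)
viewStep flat low       = lower []
viewStep flat down      = glued false final
viewStep flat high      = glued true final
viewStep (lower p) low  = lower (low ∷ p)
viewStep (lower p) down = glued false here
viewStep (lower p) high = glued true here
viewStep (glued true cut)  up   = glued true (there {l = up} cut)
viewStep (glued {h = zero}  true cut) low = lower (glue true cut)
viewStep (glued {h = suc _} true cut) low = glued false (there {l = up} cut)
viewStep (glued true cut)  down = glued false (there {l = high} cut)
viewStep (glued true cut)  high = glued true (there {l = high} cut)
viewStep (glued false cut) up   = glued true (there {l = low} cut)
viewStep (glued false cut) low  = glued false (there {l = low} cut)
viewStep (glued false cut) down = glued false (there {l = down} cut)
viewStep (glued false cut) high = glued true (there {l = down} cut)

-- A low step at height 0 is recognised before the rest of the path is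
-- inspected, so that view (low ∷ p) then reduces to lower p.
viewLow : ∀ h {p : Motzkin h m} → View p → View (low ∷ p)
viewLow zero    {p} _ = lower p
viewLow (suc h) v     = viewStep v low

viewCons : (l : Letter h h′) {p : Motzkin h′ m} → View p → View (l ∷ p)
viewCons low  v = viewLow _ v
viewCons up   v = viewStep v up
viewCons down v = viewStep v down
viewCons high v = viewStep v high

view : (p : Motzkin h m) → View p
view []      = flat
view (l ∷ p) = viewCons l (view p)


view-glue : ∀ c {p : Motzkin h m} {k} (cut : Cut p k) → view (glue c cut) ≡ glued c cut
view-glue true  final    = refl
view-glue false final    = refl
view-glue true  here     = refl
view-glue false here     = refl
view-glue c (there {l = l} cut) =
  trans (cong (viewCons (carry c l)) (view-glue (inDes l) cut)) (viewCons-carry c l cut)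
  where
  viewCons-carry : ∀ {h h′ m} c (l : Letter h h′) {p : Motzkin h′ m} {k} (cut : Cut p k) →
                   viewCons (carry c l) (glued (inDes l) cut) ≡ glued c (there {l = l} cut)
  viewCons-carry true  up   cut = refl
  viewCons-carry true  down cut = refl
  viewCons-carry true  low  cut = refl
  viewCons-carry true  high cut = refl
  viewCons-carry false up   cut = refl
  viewCons-carry false down cut = refl
  viewCons-carry false low  cut = refl
  viewCons-carry false high cut = refl

-- Inserting a first value into a permutation

toℕ-punchIn-below : ∀ (J : Fin (suc n)) w → w < J → toℕ (punchIn J w) ≡ toℕ w
toℕ-punchIn-below (suc J) zero    _   = refl
toℕ-punchIn-below (suc J) (suc w) w<J = cong suc (toℕ-punchIn-below J w (s<s⁻¹ w<J))

toℕ-punchIn-above : ∀ (J : Fin (suc n)) w → J ≤ w → toℕ (punchIn J w) ≡ suc (toℕ w)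
toℕ-punchIn-above zero    w       _   = refl
toℕ-punchIn-above (suc J) (suc w) J≤w = cong suc (toℕ-punchIn-above J w (s≤s⁻¹ J≤w))

w≤punchIn : ∀ (J : Fin (suc n)) w → w ≤ punchIn J w
w≤punchIn zero    w       = ℕ.n≤1+n _
w≤punchIn (suc J) zero    = z≤n
w≤punchIn (suc J) (suc w) = s≤s (w≤punchIn J w)

punchIn≤1+w : ∀ (J : Fin (suc n)) w → punchIn J w ≤ suc w
punchIn≤1+w zero    w       = ℕ.≤-refl
punchIn≤1+w (suc J) zero    = z≤n
punchIn≤1+w (suc J) (suc w) = s≤s (punchIn≤1+w J w)

punchIn<J⇒w<J : ∀ (J : Fin (suc n)) w → punchIn J w < J → w < J
punchIn<J⇒w<J J w lt = ℕ.≤-<-trans (w≤punchIn J w) lt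

J<punchIn⇒J≤w : ∀ (J : Fin (suc n)) w → J < punchIn J w → J ≤ w
J<punchIn⇒J≤w J w lt = s≤s⁻¹ (ℕ.<-≤-trans lt (punchIn≤1+w J w))

punchIn-mono-< : ∀ i (j k : Fin n) → j < k → punchIn i j < punchIn i k
punchIn-mono-< i j k j<k = ℕ.≰⇒> (λ le → ℕ.<⇒≱ j<k (punchIn-cancel-≤ i k j le))

punchIn-cancel-< : ∀ i (j k : Fin n) → punchIn i j < punchIn i k → j < k
punchIn-cancel-< i j k lt = ℕ.≰⇒> (λ le → ℕ.<⇒≱ lt (punchIn-mono-≤ i k j le))

punchIn-cover : ∀ {P : Fin (suc n) → Set} J → P J → (∀ w → P (punchIn J w)) → ∀ v → P v
punchIn-cover {P = P} J pJ pI v with J ≟ v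
... | yes refl = pJ
... | no  J≢v  = subst P (punchIn-punchOut J≢v) (pI (punchOut J≢v))

-- Skipping the value J preserves adjacency except across J.
punchIn-adjacent⁺ : ∀ (J : Fin (suc n)) w w′ → toℕ J ≢ suc (toℕ w) → toℕ w′ ≡ suc (toℕ w) →
                    toℕ (punchIn J w′) ≡ suc (toℕ (punchIn J w))
punchIn-adjacent⁺ J w w′ J≢1+w w′≡1+w with toℕ w ℕ.<? toℕ J
... | yes w<J rewrite toℕ-punchIn-below J w w<J =
  trans (toℕ-punchIn-below J w′ w′<J) w′≡1+w
  where
  w′<J : w′ < J
  w′<J = subst (ℕ._< toℕ J) (sym w′≡1+w) (ℕ.≤∧≢⇒< w<J (J≢1+w ∘ sym))
... | no w≮J rewrite toℕ-punchIn-above J w (ℕ.≮⇒≥ w≮J) =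
  trans (toℕ-punchIn-above J w′ J≤w′) (cong suc w′≡1+w)
  where
  J≤w′ : J ≤ w′
  J≤w′ = subst (toℕ J ℕ.≤_) (sym w′≡1+w) (ℕ.m≤n⇒m≤1+n (ℕ.≮⇒≥ w≮J))

punchIn-adjacent⁻ : ∀ (J : Fin (suc n)) w w′ → toℕ J ≢ suc (toℕ w) →
                    toℕ (punchIn J w′) ≡ suc (toℕ (punchIn J w)) → toℕ w′ ≡ suc (toℕ w)
punchIn-adjacent⁻ J w w′ J≢1+w eq with toℕ w ℕ.<? toℕ J
... | yes w<J rewrite toℕ-punchIn-below J w w<J =
  trans (sym (toℕ-punchIn-below J w′ (punchIn<J⇒w<J J w′ lt))) eq
  where
  lt : punchIn J w′ < J
  lt = subst (ℕ._< toℕ J) (sym eq) (ℕ.≤∧≢⇒< w<J (J≢1+w ∘ sym))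
... | no w≮J rewrite toℕ-punchIn-above J w (ℕ.≮⇒≥ w≮J) =
  ℕ.suc-injective (trans (sym (toℕ-punchIn-above J w′ (J<punchIn⇒J≤w J w′ lt))) eq)
  where
  lt : J < punchIn J w′
  lt = subst (toℕ J ℕ.<_) (sym eq) (s≤s (ℕ.m≤n⇒m≤1+n (ℕ.≮⇒≥ w≮J)))

-- The values smaller than J stand to the left of the others.
Splits : Permutation′ n → Fin (suc n) → Set
Splits π J = ∀ x y → (π ⟨$⟩ʳ x) < J → J ≤ (π ⟨$⟩ʳ y) → x < y

module _ (J : Fin (suc n)) (π : Permutation′ n) where

  private
    σ : Permutation′ (suc n)
    σ = insert zero J π

  avoids-insert⁺ : Splits π J → Avoids231 π → Avoids231 σ
  avoids-insert⁺ splits av (zero , suc j , suc k , _ , s≤s j<k , k<i , i<j) =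
    ℕ.<-asym j<k (splits k j (punchIn<J⇒w<J J _ k<i) (J<punchIn⇒J≤w J _ i<j))
  avoids-insert⁺ splits av (suc i , suc j , suc k , s≤s i<j , s≤s j<k , σk<σi , σi<σj) =
    av (i , j , k , i<j , j<k , punchIn-cancel-< J _ _ σk<σi , punchIn-cancel-< J _ _ σi<σj)

  avoids-insert⁻ : Avoids231 σ → Avoids231 π
  avoids-insert⁻ av (i , j , k , i<j , j<k , σk<σi , σi<σj) =
    av (suc i , suc j , suc k , s≤s i<j , s≤s j<k ,
        punchIn-mono-< J _ _ σk<σi , punchIn-mono-< J _ _ σi<σj)

  -- A violation of the splitting, together with the first value J, is an
  -- occurrence of 231.
  avoids-insert⇒splits : Avoids231 σ → Splits π J
  avoids-insert⇒splits av x y πx<J J≤πy with toℕ x ℕ.<? toℕ y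
  ... | yes x<y = x<y
  ... | no  x≮y = contradiction
    (zero , suc y , suc x , s≤s z≤n , s≤s (ℕ.≤∧≢⇒< (ℕ.≮⇒≥ x≮y) y≢x) ,
     subst (ℕ._< toℕ J) (sym (toℕ-punchIn-below J _ πx<J)) πx<J ,
     subst (toℕ J ℕ.<_) (sym (toℕ-punchIn-above J _ J≤πy)) (s≤s J≤πy))
    av
    where
    y≢x : toℕ y ≢ toℕ x
    y≢x eq with refl ← toℕ-injective eq = ℕ.<⇒≱ πx<J J≤πy

  splits-insert⁺ : ∀ K → J ≤ K → Splits π K → Splits σ (suc K)
  splits-insert⁺ K J≤K splits zero    zero    σx<K K≤σy = contradiction K≤σy (ℕ.<⇒≱ σx<K)
  splits-insert⁺ K J≤K splits zero    (suc y) σx<K K≤σy = s≤s z≤n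
  splits-insert⁺ K J≤K splits (suc x) zero    σx<K K≤σy = contradiction J≤K (ℕ.<⇒≱ K≤σy)
  splits-insert⁺ K J≤K splits (suc x) (suc y) σx<K K≤σy =
    s≤s (splits x y πx<K (s≤s⁻¹ (ℕ.≤-trans K≤σy (punchIn≤1+w J _))))
    where
    πx<K : (π ⟨$⟩ʳ x) < K
    πx<K with toℕ (π ⟨$⟩ʳ x) ℕ.<? toℕ J
    ... | yes πx<J = ℕ.<-≤-trans πx<J J≤K
    ... | no  πx≮J = s<s⁻¹ (subst (ℕ._< suc (toℕ K)) (toℕ-punchIn-above J _ (ℕ.≮⇒≥ πx≮J)) σx<K)

  -- Otherwise the first value J is at least suc K, and the value 0 would
  -- have to stand to its left.
  splits-insert⇒≤ : ∀ K → Splits σ (suc K) → J ≤ K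
  splits-insert⇒≤ K splits with toℕ K ℕ.<? toℕ J
  ... | no  K≮J = ℕ.≮⇒≥ K≮J
  ... | yes K<J = contradiction
    (splits (σ ⟨$⟩ˡ zero) zero (subst (_< suc K) (sym (inverseʳ σ)) (s≤s z≤n)) K<J) λ ()

  splits-insert⁻ : ∀ K → Splits σ (suc K) → Splits π K
  splits-insert⁻ K splits x y πx<K K≤πy =
    s<s⁻¹ (splits (suc x) (suc y) (s≤s (ℕ.≤-trans (punchIn≤1+w J _) πx<K)) 1+K≤σy)
    where
    1+K≤σy : suc K ≤ punchIn J (π ⟨$⟩ʳ y)
    1+K≤σy = subst (suc (toℕ K) ℕ.≤_)
      (sym (toℕ-punchIn-above J _ (ℕ.≤-trans (splits-insert⇒≤ K splits) K≤πy))) (s≤s K≤πy)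

  descent-insert⁺ : ∀ {i} → IsDescent π i → IsDescent σ (suc i)
  descent-insert⁺ (j , j≡1+i , πj<πi) = suc j , cong suc j≡1+i , punchIn-mono-< J _ _ πj<πi

  descent-insert⁻ : ∀ {i} → IsDescent σ (suc i) → IsDescent π i
  descent-insert⁻ (suc j , j≡1+i , σj<σi) =
    j , ℕ.suc-injective j≡1+i , punchIn-cancel-< J _ _ σj<σi

  insert-⟨$⟩ˡ-new : σ ⟨$⟩ˡ J ≡ zero
  insert-⟨$⟩ˡ-new = inverseˡ σ {zero}

  insert-⟨$⟩ˡ-old : ∀ w → σ ⟨$⟩ˡ punchIn J w ≡ suc (π ⟨$⟩ˡ w)
  insert-⟨$⟩ˡ-old w =
    trans (cong (λ v → σ ⟨$⟩ˡ punchIn J v) (sym (inverseʳ π))) (inverseˡ σ {suc (π ⟨$⟩ˡ w)})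

  ¬idescent-insert-new : ¬ IsDescent (flip σ) J
  ¬idescent-insert-new (j , _ , lt) with () ← subst ((σ ⟨$⟩ˡ j) <_) insert-⟨$⟩ˡ-new lt

  -- The value J stands first, hence to the left of its predecessor.
  idescent-insert-cut : ∀ w → toℕ J ≡ suc (toℕ w) → IsDescent (flip σ) (punchIn J w)
  idescent-insert-cut w J≡1+w =
    J , trans J≡1+w (cong suc (sym (toℕ-punchIn-below J w (ℕ.≤-reflexive (sym J≡1+w))))) ,
    subst₂ _<_ (sym insert-⟨$⟩ˡ-new) (sym (insert-⟨$⟩ˡ-old w)) (s≤s z≤n)

  idescent-insert⁺ : ∀ w → toℕ J ≢ suc (toℕ w) →
                     IsDescent (flip π) w → IsDescent (flip σ) (punchIn J w)
  idescent-insert⁺ w J≢1+w (w′ , w′≡1+w , lt) =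
    punchIn J w′ , punchIn-adjacent⁺ J w w′ J≢1+w w′≡1+w ,
    subst₂ _<_ (sym (insert-⟨$⟩ˡ-old w′)) (sym (insert-⟨$⟩ˡ-old w)) (s≤s lt)

  idescent-insert⁻ : ∀ w → toℕ J ≢ suc (toℕ w) →
                     IsDescent (flip σ) (punchIn J w) → IsDescent (flip π) w
  idescent-insert⁻ w J≢1+w (j , j≡1+i , lt) = punchIn-cover {P = Goal} J new old j j≡1+i lt
    where
    Goal : Fin (suc n) → Set
    Goal j = toℕ j ≡ suc (toℕ (punchIn J w)) → (σ ⟨$⟩ˡ j) < (σ ⟨$⟩ˡ punchIn J w) →
             IsDescent (flip π) w
    new : Goal J
    new J≡1+i _ = contradiction
      (trans J≡1+i (cong suc (toℕ-punchIn-below J w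
        (punchIn<J⇒w<J J w (ℕ.≤-reflexive (sym J≡1+i)))))) J≢1+w
    old : ∀ w′ → Goal (punchIn J w′)
    old w′ eq lt = w′ , punchIn-adjacent⁻ J w w′ J≢1+w eq ,
      s<s⁻¹ (subst₂ _<_ (insert-⟨$⟩ˡ-old w′) (insert-⟨$⟩ˡ-old w) lt)

-- If suc k splits π, then the first value of π is at most k, because the
-- value 0 cannot stand to its left.
descent-insert-zero : ∀ (k : Fin (suc n)) π → Splits π (suc k) →
                      IsDescent (insert zero (suc k) π) zero
descent-insert-zero k π splits =
  suc zero , refl , subst (ℕ._< suc (toℕ k)) (sym (toℕ-punchIn-below (suc k) _ π₀<J)) π₀<J
  where
  π₀<J : (π ⟨$⟩ʳ zero) < suc k
  π₀<J with toℕ (π ⟨$⟩ʳ zero) ℕ.<? suc (toℕ k)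
  ... | yes lt = lt
  ... | no  ge = contradiction
    (splits (π ⟨$⟩ˡ zero) zero (subst (_< suc k) (sym (inverseʳ π)) (s≤s z≤n)) (ℕ.≮⇒≥ ge)) λ ()

-- The permutation coded by a path

-- p Codes σ: the words of p are the descent words of σ and σ⁻¹, as
-- proved in codes⇒marks-des and codes⇒marks-ides.
infix 4 _Codes_
data _Codes_ : Motzkin 0 m → Permutation′ (suc m) → Set where
  flat  : [] Codes id
  lower : {p : Motzkin 0 m} {π : Permutation′ (suc m)} →
          p Codes π → (low ∷ p) Codes insert zero zero π
  glued : ∀ {p : Motzkin 0 m} {π : Permutation′ (suc m)} {k} →
          p Codes π → (cut : Cut p k) → glue true cut Codes insert zero (suc k) π

-- Inserting the first values as the views of a path prescribe.  The
-- height is left general, and only required to be 0 by an equation,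
-- because the index of View (glue c cut) contains the function lift.
decodeView : {p : Motzkin h m} → View p → h ≡ 0 → Permutation′ (suc m)
decodeView {m = zero}  _ _ = id
decodeView {m = suc m} (lower p) _ = insert zero zero (decodeView (view p) refl)
decodeView {m = suc m} (glued true {p} {k} cut) h≡0 = insert zero (suc k) (decodeView (view p) h≡0)

decode : Motzkin 0 m → Permutation′ (suc m)
decode p = decodeView (view p) refl

decode-glue : {p : Motzkin 0 m} {k : Fin (suc m)} (cut : Cut p k) →
              decode (glue true cut) ≡ insert zero (suc k) (decode p)
decode-glue cut = cong (λ v → decodeView v refl) (view-glue true cut)

codes-decodeView : ∀ {p : Motzkin h m} (v : View p) (h≡0 : h ≡ 0) →
                   subst (λ h → Motzkin h m) h≡0 p Codes decodeView v h≡0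
codes-decodeView flat refl = flat
codes-decodeView (lower p) refl = lower (codes-decodeView (view p) refl)
codes-decodeView (glued true {p} cut) refl = glued (codes-decodeView (view p) refl) cut

codes-decode : (p : Motzkin 0 m) → p Codes decode p
codes-decode p = codes-decodeView (view p) refl

codes⇒decode : {p : Motzkin 0 m} {σ : Permutation′ (suc m)} → p Codes σ → σ ≡ decode p
codes⇒decode flat            = refl
codes⇒decode (lower c)       = cong (insert zero zero) (codes⇒decode c)
codes⇒decode (glued c cut)   =
  trans (cong (insert zero _) (codes⇒decode c)) (sym (decode-glue cut))

splits-zero : (π : Permutation′ n) → Splits π zero
splits-zero π x y ()

-- k is a cut of the path of σ if and only if suc k splits σ.
cut⇒splits : ∀ {p : Motzkin 0 m} {σ k} → p Codes σ → Cut p k → Splits σ (suc k)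
cut⇒splits flat final x zero _ ()
cut⇒splits (lower {π = π} c) here        = splits-insert⁺ zero π zero z≤n (splits-zero π)
cut⇒splits (lower {π = π} c) (there cut) =
  splits-insert⁺ zero π (suc _) z≤n (cut⇒splits c cut)
cut⇒splits {k = zero}   (glued c cut) cut′ = contradiction cut′ (¬cut-glue-zero true cut)
cut⇒splits {k = suc k′} (glued {π = π} {k} c cut) cut′
  with k≤k′ , cut″ ← cut-glue⁻ true cut cut′ =
  splits-insert⁺ (suc k) π (suc k′) (s≤s k≤k′) (cut⇒splits c cut″)

splits⇒cut : ∀ {p : Motzkin 0 m} {σ k} → p Codes σ → Splits σ (suc k) → Cut p k
splits⇒cut {k = zero}  flat splits = final
splits⇒cut {k = zero}  (lower c) splits = here
splits⇒cut {k = suc k} (lower {π = π} c) splits =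
  there (splits⇒cut c (splits-insert⁻ zero π (suc k) splits))
splits⇒cut {k = zero}  (glued {π = π} {k} c cut) splits =
  contradiction (splits-insert⇒≤ (suc k) π zero splits) λ ()
splits⇒cut {k = suc k′} (glued {π = π} {k} c cut) splits =
  cut-glue⁺ true cut (s≤s⁻¹ (splits-insert⇒≤ (suc k) π (suc k′) splits))
    (splits⇒cut c (splits-insert⁻ (suc k) π (suc k′) splits))

codes⇒avoids : {p : Motzkin 0 m} {σ : Permutation′ (suc m)} → p Codes σ → Avoids231 σ
codes⇒avoids flat (zero , zero , _ , () , _)
codes⇒avoids (lower {π = π} c) =
  avoids-insert⁺ zero π (splits-zero π) (codes⇒avoids c)
codes⇒avoids (glued {π = π} {k} c cut) =
  avoids-insert⁺ (suc k) π (cut⇒splits c cut) (codes⇒avoids c)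

-- The word A marks exactly the descents of σ.
Marks : Permutation′ n → (Fin n → Bool) → Set
Marks σ A = ∀ i → Reflects (IsDescent σ i) (A i)

reflects-⇔ : ∀ {P Q : Set} {b} → (P → Q) → (Q → P) → Reflects P b → Reflects Q b
reflects-⇔ {b = b} f g r = proof (map′ f g (b because r))

¬descent-singleton : (σ : Permutation′ 1) (i : Fin 1) → ¬ IsDescent σ i
¬descent-singleton σ i (zero , () , _)

codes⇒marks-des : {p : Motzkin 0 m} {σ : Permutation′ (suc m)} → p Codes σ → Marks σ (des p)
codes⇒marks-des flat i = ofⁿ (¬descent-singleton id i)
codes⇒marks-des (lower c) zero = ofⁿ λ { (_ , _ , ()) }
codes⇒marks-des (lower {π = π} c) (suc i) =
  reflects-⇔ (descent-insert⁺ zero π) (descent-insert⁻ zero π) (codes⇒marks-des c i)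
codes⇒marks-des (glued {π = π} {k} c cut) zero =
  subst (Reflects _) (sym (des-glue-zero true cut))
    (ofʸ (descent-insert-zero k π (cut⇒splits c cut)))
codes⇒marks-des (glued {π = π} {k} c cut) (suc i) =
  subst (Reflects _) (sym (des-glue-suc true cut i))
    (reflects-⇔ (descent-insert⁺ (suc k) π) (descent-insert⁻ (suc k) π) (codes⇒marks-des c i))

codes⇒marks-ides : {p : Motzkin 0 m} {σ : Permutation′ (suc m)} →
                   p Codes σ → Marks (flip σ) (ides p)
codes⇒marks-ides flat i = ofⁿ (¬descent-singleton (flip id) i)
codes⇒marks-ides (lower {π = π} c) zero = ofⁿ (¬idescent-insert-new zero π)
codes⇒marks-ides (lower {π = π} c) (suc w) =
  reflects-⇔ (idescent-insert⁺ zero π w λ ()) (idescent-insert⁻ zero π w λ ())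
    (codes⇒marks-ides c w)
codes⇒marks-ides (glued {π = π} {k} c cut) =
  punchIn-cover {P = λ v → Reflects (IsDescent (flip (insert zero (suc k) π)) v) (ides (glue true cut) v)}
    (suc k) new old
  where
  new : Reflects _ _
  new = subst (Reflects _) (sym (ides-glue-new true cut)) (ofⁿ (¬idescent-insert-new (suc k) π))
  old : ∀ w → Reflects _ _
  old w with w ≟ k
  ... | yes refl = subst (Reflects _) (sym (ides-glue-cut true cut))
                     (ofʸ (idescent-insert-cut (suc k) π k refl))
  ... | no  w≢k  = subst (Reflects _) (sym (ides-glue-old true cut w w≢k))
                     (reflects-⇔ (idescent-insert⁺ (suc k) π w k≢w) (idescent-insert⁻ (suc k) π w k≢w)
                       (codes⇒marks-ides c w))
    where
    k≢w : suc (toℕ k) ≢ suc (toℕ w)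
    k≢w eq = w≢k (sym (toℕ-injective (ℕ.suc-injective eq)))

-- Pointwise equality of permutations

contains-resp-≈ : {σ ρ : Permutation′ n} → σ ≈ ρ → Contains231 σ → Contains231 ρ
contains-resp-≈ σ≈ρ (i , j , k , i<j , j<k , lt₁ , lt₂) =
  i , j , k , i<j , j<k , subst₂ _<_ (σ≈ρ k) (σ≈ρ i) lt₁ , subst₂ _<_ (σ≈ρ i) (σ≈ρ j) lt₂

≈-sym : {σ ρ : Permutation′ n} → σ ≈ ρ → ρ ≈ σ
≈-sym σ≈ρ i = sym (σ≈ρ i)

avoids-resp-≈ : {σ ρ : Permutation′ n} → σ ≈ ρ → Avoids231 σ → Avoids231 ρ
avoids-resp-≈ {σ = σ} {ρ} σ≈ρ av c =
  av (contains-resp-≈ {σ = ρ} {σ} (≈-sym {σ = σ} {ρ} σ≈ρ) c)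

splits-resp-≈ : {σ ρ : Permutation′ n} {J : Fin (suc n)} → σ ≈ ρ → Splits σ J → Splits ρ J
splits-resp-≈ {J = J} σ≈ρ splits x y lt le =
  splits x y (subst (_< J) (sym (σ≈ρ x)) lt) (subst (J ≤_) (sym (σ≈ρ y)) le)

flip-cong : {σ ρ : Permutation′ n} → σ ≈ ρ → flip σ ≈ flip ρ
flip-cong {σ = σ} {ρ} σ≈ρ v =
  trans (cong (σ ⟨$⟩ˡ_) (trans (sym (inverseʳ ρ)) (sym (σ≈ρ (ρ ⟨$⟩ˡ v))))) (inverseˡ σ)

isDescent-resp-≈ : {σ ρ : Permutation′ n} → σ ≈ ρ → ∀ {i} → IsDescent σ i → IsDescent ρ i
isDescent-resp-≈ σ≈ρ (j , eq , lt) = j , eq , subst₂ _<_ (σ≈ρ j) (σ≈ρ _) lt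

marks-resp-≈ : {σ ρ : Permutation′ n} {A : Fin n → Bool} → σ ≈ ρ → Marks σ A → Marks ρ A
marks-resp-≈ {σ = σ} {ρ} σ≈ρ marks i =
  reflects-⇔ (isDescent-resp-≈ {σ = σ} {ρ} σ≈ρ)
    (isDescent-resp-≈ {σ = ρ} {σ} (≈-sym {σ = σ} {ρ} σ≈ρ)) (marks i)

-- Every 231-avoiding permutation has a code, found by deleting its first
-- value.
encode : ∀ m (σ : Permutation′ (suc m)) → Avoids231 σ → ∃[ p ] decode {m} p ≈ σ
encode zero    σ av = [] , λ { zero → Fin1-irrelevant }
  where
  Fin1-irrelevant : {i j : Fin 1} → i ≡ j
  Fin1-irrelevant {zero} {zero} = refl
encode (suc m) σ av = extend (σ ⟨$⟩ʳ zero) (insert-remove zero σ)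
  where
  π : Permutation′ (suc m)
  π = remove zero σ
  extend : ∀ J → insert zero J π ≈ σ → ∃[ p ] decode {suc m} p ≈ σ
  extend J σ′≈σ = close J refl
    where
    σ′ = insert zero J π
    av′ : Avoids231 σ′
    av′ = avoids-resp-≈ {σ = σ} {σ′} (≈-sym {σ = σ′} {σ} σ′≈σ) av
    IH : ∃[ p ] decode {m} p ≈ π
    IH = encode m π (avoids-insert⁻ J π av′)
    p = proj₁ IH
    ρ = decode p
    p≈π = proj₂ IH
    to-σ : ∀ {K} → J ≡ K → insert zero K ρ ≈ σ
    to-σ refl i = trans (insert-cong {j = J} {π = ρ} {π} refl p≈π i) (σ′≈σ i)
    close : ∀ K → J ≡ K → ∃[ p ] decode {suc m} p ≈ σ
    close zero    J≡K = low ∷ p , to-σ J≡K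
    close (suc k) refl = glue true cut ,
      λ i → trans (cong (_⟨$⟩ʳ i) (decode-glue cut)) (to-σ refl i)
      where
      cut : Cut p k
      cut = splits⇒cut (codes-decode p)
        (splits-resp-≈ {σ = π} {ρ} (≈-sym {σ = ρ} {π} p≈π) (avoids-insert⇒splits J π av′))

-- Major indices

-- The sum of the marked positions, where positions are counted from o.
weight : ℕ → (Fin n → Bool) → ℕ
weight {zero}  o A = 0
weight {suc n} o A = (if A zero then o else 0) ℕ.+ weight (suc o) (A ∘ suc)

-- The positions f i run through an interval, f i counting o + i.
sum-filter : ∀ {P : Fin m → Set} (P? : ∀ i → Dec (P i)) (f : Fin n → Fin m) (A : Fin n → Bool) o →
             (∀ i → does (P? (f i)) ≡ A i) → (∀ i → suc (toℕ (f i)) ≡ o ℕ.+ toℕ i) →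
             sum (map (λ i → suc (toℕ i)) (filter P? (tabulate f))) ≡ weight o A
sum-filter {n = zero}  P? f A o P≡A f≡o = refl
sum-filter {n = suc n} P? f A o P≡A f≡o
  with ih ← sum-filter P? (f ∘ suc) (A ∘ suc) (suc o) (P≡A ∘ suc)
              (λ i → trans (f≡o (suc i)) (ℕ.+-suc o (toℕ i)))
  with does (P? (f zero)) | A zero | P≡A zero
... | true  | _ | refl = cong₂ ℕ._+_ (trans (f≡o zero) (ℕ.+-identityʳ o)) ih
... | false | _ | refl = ih

maj-weight : (σ : Permutation′ n) {A : Fin n → Bool} → Marks σ A → maj σ ≡ weight 1 A
maj-weight σ {A} marks =
  sum-filter (isDescent? σ) (λ i → i) A 1 (λ i → det (proof (isDescent? σ i)) (marks i)) (λ _ → refl)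

-- Each of the m steps counts exactly once on the left, since inDes of the
-- exchanged step is the negation of inIDes of the step.  The summand
-- o C 2 = 1 + … + (o - 1) completes the sum o + … + (o + m - 1) to a
-- binomial coefficient.
weight-swap : ∀ o (p : Motzkin h m) →
              weight o (des (swap p)) ℕ.+ weight o (ides p) ℕ.+ o C 2 ≡ (o ℕ.+ m) C 2
weight-swap o [] = cong (_C 2) (sym (ℕ.+-identityʳ o))
weight-swap {m = suc m} o (l ∷ p) = trans (first-step l) (trans rest (cong (_C 2) (sym (ℕ.+-suc o m))))
  where
  open +-*-Solver
  a b : ℕ
  a = weight (suc o) (des (swap p))
  b = weight (suc o) (ides p)
  first-step : ∀ {h h′} (l : Letter h h′) →
               (if inDes (swapLetter l) then o else 0) ℕ.+ a ℕ.+
               ((if inIDes l then o else 0) ℕ.+ b) ℕ.+ o C 2 ≡ a ℕ.+ b ℕ.+ (o ℕ.+ o C 2)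
  first-step up   = solve 4 (λ o a b c → o :+ a :+ b :+ c := a :+ b :+ (o :+ c)) refl o a b (o C 2)
  first-step low  = solve 4 (λ o a b c → o :+ a :+ b :+ c := a :+ b :+ (o :+ c)) refl o a b (o C 2)
  first-step down = solve 4 (λ o a b c → a :+ (o :+ b) :+ c := a :+ b :+ (o :+ c)) refl o a b (o C 2)
  first-step high = solve 4 (λ o a b c → a :+ (o :+ b) :+ c := a :+ b :+ (o :+ c)) refl o a b (o C 2)
  pascal : o ℕ.+ o C 2 ≡ suc o C 2
  pascal = trans (cong (ℕ._+ o C 2) (sym (nC1≡n o))) (nCk+nC[k+1]≡[n+1]C[k+1] o 1)
  rest : a ℕ.+ b ℕ.+ (o ℕ.+ o C 2) ≡ (suc o ℕ.+ m) C 2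
  rest = trans (cong (a ℕ.+ b ℕ.+_) pascal) (weight-swap (suc o) p)

weight-des-swap : (p : Motzkin 0 m) →
                  weight 1 (des (swap p)) ≡ suc m C 2 ∸ weight 1 (ides p)
weight-des-swap p = trans (sym (ℕ.m+n∸n≡m _ (weight 1 (ides p))))
  (cong (_∸ weight 1 (ides p)) (trans (sym (ℕ.+-identityʳ _)) (weight-swap 1 p)))

-- A path is determined by the descents of its permutation and of the
-- inverse.
decode-injective : (p p′ : Motzkin 0 m) → decode p ≈ decode p′ → p ≡ p′
decode-injective p p′ eq = des-ides-injective p p′
  (λ i → det (codes⇒marks-des (codes-decode p) i)
    (marks-resp-≈ {σ = decode p′} {decode p} (≈-sym {σ = decode p} {decode p′} eq)
      (codes⇒marks-des (codes-decode p′)) i))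
  (λ i → det (codes⇒marks-ides (codes-decode p) i)
    (marks-resp-≈ {σ = flip (decode p′)} {flip (decode p)}
      (flip-cong {σ = decode p′} {decode p} (≈-sym {σ = decode p} {decode p′} eq))
      (codes⇒marks-ides (codes-decode p′)) i))

maj-code : (p : Motzkin 0 m) (σ : Permutation′ (suc m)) → decode p ≈ σ → maj σ ≡ weight 1 (des p)
maj-code p σ eq = maj-weight σ (marks-resp-≈ {σ = decode p} {σ} eq (codes⇒marks-des (codes-decode p)))

imaj-code : (p : Motzkin 0 m) (σ : Permutation′ (suc m)) → decode p ≈ σ → imaj σ ≡ weight 1 (ides p)
imaj-code p σ eq = maj-weight (flip σ) (marks-resp-≈ {σ = flip (decode p)} {flip σ}
  (flip-cong {σ = decode p} {σ} eq) (codes⇒marks-ides (codes-decode p)))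

-- The exponent of the second variable of 𝒜.
coimaj : Permutation′ n → ℕ
coimaj {n} σ = n C 2 ∸ imaj σ

maj-cong : {σ ρ : Permutation′ n} → σ ≈ ρ → maj σ ≡ maj ρ
maj-cong {σ = σ} {ρ} eq = trans (maj-weight σ marks) (sym (maj-weight ρ (marks-resp-≈ {σ = σ} {ρ} eq marks)))
  where
  marks : Marks σ (λ i → does (isDescent? σ i))
  marks i = proof (isDescent? σ i)

coimaj-cong : {σ ρ : Permutation′ n} → σ ≈ ρ → coimaj σ ≡ coimaj ρ
coimaj-cong {n} {σ} {ρ} eq =
  cong (n C 2 ∸_) (maj-cong {σ = flip σ} {flip ρ} (flip-cong {σ = σ} {ρ} eq))

-- The exchange of colours, transported to the 231-avoiding permutations.
module _ {m} (σ : Permutation′ (suc m)) (av : Avoids231 σ) where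

  private
    p : Motzkin 0 m
    p = proj₁ (encode m σ av)

  dual : Permutation′ (suc m)
  dual = decode (swap p)

  dual-avoids : Avoids231 dual
  dual-avoids = codes⇒avoids (codes-decode (swap p))

  maj-dual : maj dual ≡ coimaj σ
  maj-dual = trans (maj-code (swap p) dual (λ _ → refl)) (trans (weight-des-swap p)
    (cong (suc m C 2 ∸_) (sym (imaj-code p σ (proj₂ (encode m σ av))))))

  coimaj-dual : coimaj dual ≡ maj σ
  coimaj-dual = trans (cong (suc m C 2 ∸_) (imaj-code (swap p) dual (λ _ → refl)))
    (trans (sym (weight-des-swap (swap p)))
    (trans (cong (weight 1 ∘ des) (swap-involutive p)) (sym (maj-code p σ (proj₂ (encode m σ av))))))

dual-injective : (σ ρ : Permutation′ (suc m)) (avσ : Avoids231 σ) (avρ : Avoids231 ρ) →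
                 dual σ avσ ≈ dual ρ avρ → σ ≈ ρ
dual-injective {m} σ ρ avσ avρ eq i =
  trans (sym (pσ≈σ i)) (trans (cong (λ p → decode p ⟨$⟩ʳ i) pσ≡pρ) (pρ≈ρ i))
  where
  pσ = proj₁ (encode m σ avσ)
  pρ = proj₁ (encode m ρ avρ)
  pσ≈σ = proj₂ (encode m σ avσ)
  pρ≈ρ = proj₂ (encode m ρ avρ)
  pσ≡pρ : pσ ≡ pρ
  pσ≡pρ = trans (sym (swap-involutive pσ))
    (trans (cong swap (decode-injective (swap pσ) (swap pρ) eq)) (swap-involutive pρ))

-- Counting

module _ {c ℓ} (S : Setoid c ℓ) where

  open Setoid S using (Carrier) renaming (_≈_ to _≋_; sym to ≋-sym)
  open Membership S using (_∈_)

  lookup-injective : ∀ {xs} → Unique S xs → ∀ i j → lookup xs i ≋ lookup xs j → i ≡ j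
  lookup-injective (_ ∷ _)  zero    zero    _  = refl
  lookup-injective (x≉ ∷ _) zero    (suc j) eq = contradiction eq (All.lookup x≉ (∈-lookup j))
  lookup-injective (x≉ ∷ _) (suc i) zero    eq = contradiction (≋-sym eq) (All.lookup x≉ (∈-lookup i))
  lookup-injective (_ ∷ u)  (suc i) (suc j) eq = cong suc (lookup-injective u i j eq)

  injection⇒length≤ : ∀ {xs ys} → Unique S xs → (f : ∀ x → x ∈ xs → Carrier) →
    (∀ x x∈xs → f x x∈xs ∈ ys) →
    (∀ x y x∈xs y∈xs → f x x∈xs ≋ f y y∈xs → x ≋ y) →
    length xs ℕ.≤ length ys
  injection⇒length≤ {xs} {ys} u f f∈ys f-inj = injective⇒≤ {f = position} λ {i} {j} eq →
    lookup-injective u i j (f-inj _ _ _ _ (Membershipₚ.index-injective S (f∈ys _ _) (f∈ys _ _) eq))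
    where
    position : Fin (length xs) → Fin (length ys)
    position i = index (f∈ys (lookup xs i) (Membershipₚ.∈-lookup S xs i))

-- The 231-avoiding permutations on which the statistics u and v take the
-- values a and b, and their number.
module _ {n} (u v : Permutation′ n → ℕ) (a b : ℕ) where

  hasStatistics? : ∀ σ → Dec (u σ ≡ a × v σ ≡ b)
  hasStatistics? σ = (u σ ℕ.≟ a) ×-dec (v σ ℕ.≟ b)

  count : ℕ
  count = length (filter hasStatistics? (𝒮⟨231⟩ n))

count-swap-≤ : (u v : Permutation′ (suc m) → ℕ) →
  (∀ {σ ρ} → σ ≈ ρ → u σ ≡ u ρ) → (∀ {σ ρ} → σ ≈ ρ → v σ ≡ v ρ) →
  (∀ σ av → u (dual σ av) ≡ v σ) → (∀ σ av → v (dual σ av) ≡ u σ) →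
  ∀ a b → count u v a b ℕ.≤ count v u a b
count-swap-≤ {m} u v u-cong v-cong u-dual v-dual a b =
  injection⇒length≤ S
    (Unique.filter⁺ S (hasStatistics? u v a b) (Unique.filter⁺ S avoids231? (𝒮-unique (suc m))))
    (λ σ σ∈ → dual σ (avoids σ σ∈)) member
    (λ σ ρ σ∈ ρ∈ → dual-injective σ ρ (avoids σ σ∈) (avoids ρ ρ∈))
  where
  S = ≈-setoid (suc m)
  open Membership S using (_∈_)
  statistics-resp : ∀ (u v : Permutation′ (suc m) → ℕ) →
    (∀ {σ ρ} → σ ≈ ρ → u σ ≡ u ρ) → (∀ {σ ρ} → σ ≈ ρ → v σ ≡ v ρ) →
    ∀ {σ ρ} → σ ≈ ρ → u σ ≡ a × v σ ≡ b → u ρ ≡ a × v ρ ≡ b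
  statistics-resp u v u-cong v-cong {σ} {ρ} eq (p , r) =
    trans (sym (u-cong {σ} {ρ} eq)) p , trans (sym (v-cong {σ} {ρ} eq)) r
  split : ∀ σ → σ ∈ filter (hasStatistics? u v a b) (𝒮⟨231⟩ (suc m)) →
          σ ∈ 𝒮⟨231⟩ (suc m) × u σ ≡ a × v σ ≡ b
  split σ = Membershipₚ.∈-filter⁻ S (hasStatistics? u v a b)
    (λ {σ} {ρ} → statistics-resp u v u-cong v-cong {σ} {ρ}) {v = σ}
  avoids : ∀ σ → σ ∈ filter (hasStatistics? u v a b) (𝒮⟨231⟩ (suc m)) → Avoids231 σ
  avoids σ σ∈ = proj₂ (Membershipₚ.∈-filter⁻ S avoids231?
    (λ {σ} {ρ} → avoids-resp-≈ {σ = σ} {ρ}) {v = σ} {xs = 𝒮 (suc m)} (proj₁ (split σ σ∈)))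
  member : ∀ σ σ∈ → dual σ (avoids σ σ∈) ∈ filter (hasStatistics? v u a b) (𝒮⟨231⟩ (suc m))
  member σ σ∈ with _ , uσ≡a , vσ≡b ← split σ σ∈ =
    Membershipₚ.∈-filter⁺ S (hasStatistics? v u a b)
      (λ {σ} {ρ} → statistics-resp v u v-cong u-cong {σ} {ρ}) {v = σ′}
      (Membershipₚ.∈-filter⁺ S avoids231? (λ {σ} {ρ} → avoids-resp-≈ {σ = σ} {ρ}) {v = σ′}
        (𝒮-complete (suc m) σ′) (dual-avoids σ (avoids σ σ∈)))
      (trans (v-dual σ _) uσ≡a , trans (u-dual σ _) vσ≡b)
    where
    σ′ : Permutation′ (suc m)
    σ′ = dual σ (avoids σ σ∈)

-- Coefficients

open RawSemiring polynomialRawSemiring using (_+_; _*_; 0#)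
open RawSemiringDefinitions polynomialRawSemiring using (_^_)

q^n : ∀ n → q ^ n ≡ (1ℤ , n , 0) ∷ []
q^n zero    = refl
q^n (suc n) = cong (q *_) (q^n n)

t^n : ∀ n → t ^ n ≡ (1ℤ , 0 , n) ∷ []
t^n zero    = refl
t^n (suc n) = cong (t *_) (t^n n)

coefficient-sum : (term : Permutation′ n → Polynomial) (u v : Permutation′ n → ℕ) →
  (∀ σ → term σ ≡ (1ℤ , u σ , v σ) ∷ []) → ∀ σs a b →
  coefficient (foldr _+_ 0# (map term σs)) a b ≡ ℤ.+ length (filter (hasStatistics? u v a b) σs)
coefficient-sum term u v eq []       a b = refl
coefficient-sum term u v eq (σ ∷ σs) a b rewrite eq σ with (u σ ℕ.≟ a) ×-dec (v σ ℕ.≟ b)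
... | yes p rewrite filter-accept (hasStatistics? u v a b) {σ} {σs} p =
  cong (ℤ._+_ 1ℤ) (coefficient-sum term u v eq σs a b)
... | no ¬p rewrite filter-reject (hasStatistics? u v a b) {σ} {σs} ¬p =
  coefficient-sum term u v eq σs a b

corollary4p3 : (n : ℕ) → n ≥ 1 → 𝒜 n q t ≈ₚ 𝒜 n t q
corollary4p3 (suc m) _ a b =
  trans (coefficient-sum _ maj coimaj qt-term (𝒮⟨231⟩ (suc m)) a b)
    (trans (cong ℤ.+_ (ℕ.≤-antisym
      (count-swap-≤ {m} maj coimaj
        (λ {σ} {ρ} → maj-cong {σ = σ} {ρ}) (λ {σ} {ρ} → coimaj-cong {σ = σ} {ρ}) maj-dual coimaj-dual a b)
      (count-swap-≤ {m} coimaj maj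
        (λ {σ} {ρ} → coimaj-cong {σ = σ} {ρ}) (λ {σ} {ρ} → maj-cong {σ = σ} {ρ}) coimaj-dual maj-dual a b)))
    (sym (coefficient-sum _ coimaj maj tq-term (𝒮⟨231⟩ (suc m)) a b)))
  where
  qt-term : ∀ (σ : Permutation′ (suc m)) → q ^ maj σ * t ^ coimaj σ ≡ (1ℤ , maj σ , coimaj σ) ∷ []
  qt-term σ rewrite q^n (maj σ) | t^n (coimaj σ) | ℕ.+-identityʳ (maj σ) = refl
  tq-term : ∀ (σ : Permutation′ (suc m)) → t ^ maj σ * q ^ coimaj σ ≡ (1ℤ , coimaj σ , maj σ) ∷ []
  tq-term σ rewrite t^n (maj σ) | q^n (coimaj σ) | ℕ.+-identityʳ (maj σ) = refl
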